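{- Let $\mathcal I$ be an interpretation of a circuit signature $\Sigma$. The instant feedback rule (IF) is sound: for every combinational circuit $f\colon x+m\to x+n$, with unrolling $f^\dagger\colon m\to x+n$, the circuits $\mathrm{Tr}^x(f)\colon m\to n$ and $f^\dagger;(\mathrm{elim}_x\otimes\mathrm{id}_n)\colon m\to n$ have the same denotation, i.e. $[\![\mathrm{Tr}^x(f)]\!]^{\mathsf S}_{\mathcal I}=[\![f^\dagger;(\mathrm{elim}_x\otimes\mathrm{id}_n)]\!]^{\mathsf S}_{\mathcal I}$.
   Context: Circuits. A circuit signature $\Sigma$ consists of a finite set $\mathbf V$ of values with a distinguished value $\bullet$, a set $\mathcal P$ of primitive symbols, and functions $\mathrm{dom},\mathrm{cod}\colon\mathcal P\to\mathbb N$. A PROP is a strict symmetric monoidal category with objects $\mathbb N$ and addition as tensor on objects. $\mathbf{CCirc}_\Sigma$ is the PROP freely generated by: $p\colon\mathrm{dom}(p)\to\mathrm{cod}(p)$ for $p\in\mathcal P$, a fork $1\to2$, a join $2\to1$, an introduction $\bullet\colon0\to1$, and an elimination $1\to0$; its morphisms are combinational circuits. $\mathbf{SCirc}_\Sigma$ is the symmetric traced PROP freely generated by these together with a value $v\colon0\to1$ for each $v\in\mathbf V\setminus\{\bullet\}$ and a delay $\delta\colon1\to1$. Composition $f;g$ is in diagrammatic order; $\mathrm{Tr}^x$ sends $x+m\to x+n$ to $m\to n$. $\mathrm{fork}_n,\mathrm{elim}_n$ and $\bullet_n\colon0\to n$ are the wirewise versions on $n$ wires. Interpretation. An interpretation $\mathcal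 I$ of $\Sigma$ is a lattice order on $\mathbf V$ with $\bullet$ least (also written $\bot$) and, for each $p\in\mathcal P$, a $\bot$-preserving monotone function $[\![p]\!]\colon\mathbf V^{\mathrm{dom}(p)}\to\mathbf V^{\mathrm{cod}(p)}$. Denotation. $[\![-]\!]^{\mathsf S}_{\mathcal I}$ is the traced PROP morphism sending circuits $m\to n$ to causal, monotone, finitely specified stream functions $(\mathbf V^m)^\omega\to(\mathbf V^n)^\omega$ determined by: primitives act elementwise by $[\![p]\!]$; fork copies; join is the elementwise $\sqcup$; introduction is the constant stream $\bot$; elimination discards; $v\mapsto v::\bot::\bot::\cdots$; $\delta\mapsto(\sigma\mapsto\bot::\sigma)$; the trace of $f\colon(\mathbf V^{x+m})^\omega\to(\mathbf V^{x+n})^\omega$ is $\sigma\mapsto\pi_1(f(\mu_f(\sigma),\sigma))$, with $\mu_f(\sigma)$ the least fixed point of $\tau\mapsto\pi_0(f(\tau,\sigma))$. Unrolling. For combinational $f\colon x+m\to x+n$, its iterations $f^k\colon m\to x+n$ are $f^0\coloneqq(\bullet_x\otimes\mathrm{id}_m);f$ and $f^{k+1}\coloneqq\mathrm{fork}_m;\big((f^k;(\mathrm{id}_x\otimes\mathrm{elim}_n))\otimes\mathrm{id}_m\big);f$. The unrolling is $f^\dagger\coloneqq f^{c+1}$ where $c$ is the length of the longest chain in the lattice $\mathbf V^x$. -}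

module Defs where

open import Data.Bool using (Bool; true; false; T)
open import Data.Fin using (Fin; zero; suc)
open import Data.Fin.Properties using (injective⇒≤)
open import Data.List as List using (List; []; _∷_)
open import Data.List.Membership.Propositional using (_∈_)
open import Data.List.Membership.Propositional.Properties
  using (∈-map⁺; ∈-allFin; ∈-cartesianProductWith⁺)
open import Data.List.Relation.Unary.Any as Any using (Any; here; there; any?)
open import Data.List.Relation.Unary.Any.Properties as Any
  using (map⁺; cartesianProductWith⁺; lookup-index)
open import Data.Nat as ℕ using (ℕ; zero; suc; _+_; _*_; z≤n; s≤s)
import Data.Nat.Properties as ℕ
open import Data.Product using (∃; _×_; _,_; proj₁; proj₂)
open import Data.Sum using (_⊎_; inj₁; inj₂)
open import Data.Unit using (⊤; tt)
open import Data.Vec as Vec using (Vec; []; _∷_; _++_; take; drop; replicate)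
import Data.Vec.Properties as Vec
open import Data.Vec.Relation.Binary.Pointwise.Inductive as Pointwise
  using (Pointwise; []; _∷_)
open import Function using (_↔_; Inverse; _∘_)
open import Function.Properties.Inverse using (↔⇒↣)
open import Relation.Binary using (Decidable)
open import Relation.Binary.Lattice using (IsLattice)
open import Relation.Binary.PropositionalEquality
  using (_≡_; _≢_; refl; sym; trans; cong; cong₂; subst; subst₂)
open import Relation.Nullary using (Dec; yes; no; contradiction; ¬?)
open import Relation.Nullary.Decidable using (map′; _×-dec_; via-injection)

record Signature : Set₁ where
  field
    Value   : Set
    size    : ℕ
    finite  : Value ↔ Fin size
    •       : Value
    Prim    : Set
    dom cod : Prim → ℕ

-- `Term false G` presents the PROP freely generated by the family G, and
-- `Term true G` the symmetric traced PROP freely generated by G.  The morphisms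
-- m → n are the terms of type `Term b G m n` modulo the congruence `_≈_`.

infixl 5 _⨾_
infixr 6 _⊗_
infix  4 _≈_

data Term (traced : Bool) (G : ℕ → ℕ → Set) : ℕ → ℕ → Set where
  gen  : ∀ {m n} → G m n → Term traced G m n
  id   : ∀ n → Term traced G n n
  swap : ∀ m n → Term traced G (m + n) (n + m)
  _⨾_  : ∀ {m n p} → Term traced G m n → Term traced G n p → Term traced G m p
  _⊗_  : ∀ {m n p q} → Term traced G m n → Term traced G p q →
         Term traced G (m + p) (n + q)
  Tr   : {_ : T traced} → ∀ x {m n} → Term traced G (x + m) (x + n) → Term traced G m n

-- Objects that are equal natural numbers need not be definitionally equal;
-- `cast` identifies the corresponding hom-sets.
cast : ∀ {b G m m′ n n′} → m ≡ m′ → n ≡ n′ → Term b G m n → Term b G m′ n′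
cast refl refl f = f

data _≈_ {b : Bool} {G : ℕ → ℕ → Set} : ∀ {m n} → Term b G m n → Term b G m n → Set where
  ≈-refl  : ∀ {m n} {f : Term b G m n} → f ≈ f
  ≈-sym   : ∀ {m n} {f g : Term b G m n} → f ≈ g → g ≈ f
  ≈-trans : ∀ {m n} {f g h : Term b G m n} → f ≈ g → g ≈ h → f ≈ h

  ⨾-cong  : ∀ {m n p} {f f′ : Term b G m n} {g g′ : Term b G n p} →
            f ≈ f′ → g ≈ g′ → f ⨾ g ≈ f′ ⨾ g′
  ⊗-cong  : ∀ {m n p q} {f f′ : Term b G m n} {g g′ : Term b G p q} →
            f ≈ f′ → g ≈ g′ → f ⊗ g ≈ f′ ⊗ g′
  Tr-cong : {t : T b} → ∀ x {m n} {f f′ : Term b G (x + m) (x + n)} →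
            f ≈ f′ → Tr {_} {_} {t} x f ≈ Tr {_} {_} {t} x f′

  ⨾-assoc     : ∀ {m n p q} (f : Term b G m n) (g : Term b G n p) (h : Term b G p q) →
                (f ⨾ g) ⨾ h ≈ f ⨾ (g ⨾ h)
  ⨾-identityˡ : ∀ {m n} (f : Term b G m n) → id m ⨾ f ≈ f
  ⨾-identityʳ : ∀ {m n} (f : Term b G m n) → f ⨾ id n ≈ f

  ⊗-id        : ∀ m n → id m ⊗ id n ≈ id (m + n)
  ⊗-⨾         : ∀ {m n p m′ n′ p′} (f : Term b G m n) (g : Term b G n p)
                (f′ : Term b G m′ n′) (g′ : Term b G n′ p′) →
                (f ⊗ f′) ⨾ (g ⊗ g′) ≈ (f ⨾ g) ⊗ (f′ ⨾ g′)
  ⊗-assoc     : ∀ {m n p q r s} (f : Term b G m n) (g : Term b G p q) (h : Term b G r s) →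
                cast (ℕ.+-assoc m p r) (ℕ.+-assoc n q s) ((f ⊗ g) ⊗ h) ≈ f ⊗ (g ⊗ h)
  ⊗-identityˡ : ∀ {m n} (f : Term b G m n) → id 0 ⊗ f ≈ f
  ⊗-identityʳ : ∀ {m n} (f : Term b G m n) →
                cast (ℕ.+-identityʳ m) (ℕ.+-identityʳ n) (f ⊗ id 0) ≈ f

  swap-natural    : ∀ {m n p q} (f : Term b G m n) (g : Term b G p q) →
                    (f ⊗ g) ⨾ swap n q ≈ swap m p ⨾ (g ⊗ f)
  swap-involutive : ∀ m n → swap m n ⨾ swap n m ≈ id (m + n)
  swap-hexagon    : ∀ m n p →
                    cast (ℕ.+-assoc m n p) (sym (ℕ.+-assoc n p m))
                      ((swap m n ⊗ id p) ⨾
                       cast (sym (ℕ.+-assoc n m p)) refl (id n ⊗ swap m p))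
                    ≈ swap m (n + p)

  tightening  : {t : T b} → ∀ x {m m′ n n′} (f : Term b G m m′)
                (g : Term b G (x + m′) (x + n′)) (h : Term b G n′ n) →
                Tr {_} {_} {t} x ((id x ⊗ f) ⨾ g ⨾ (id x ⊗ h)) ≈ f ⨾ Tr {_} {_} {t} x g ⨾ h
  sliding     : {t : T b} → ∀ x y {m n} (f : Term b G (x + m) (y + n)) (g : Term b G y x) →
                Tr {_} {_} {t} x (f ⨾ (g ⊗ id n)) ≈ Tr {_} {_} {t} y ((g ⊗ id m) ⨾ f)
  vanishing₀  : {t : T b} → ∀ {m n} (f : Term b G m n) → Tr {_} {_} {t} 0 f ≈ f
  vanishing₊  : {t : T b} → ∀ x y {m n} (f : Term b G ((x + y) + m) ((x + y) + n)) →
                Tr {_} {_} {t} (x + y) f ≈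
                Tr {_} {_} {t} y (Tr {_} {_} {t} x
                  (cast (ℕ.+-assoc x y m) (ℕ.+-assoc x y n) f))
  superposing : {t : T b} → ∀ x {m n p q} (f : Term b G (x + m) (x + n)) (g : Term b G p q) →
                Tr {_} {_} {t} x (cast (ℕ.+-assoc x m p) (ℕ.+-assoc x n q) (f ⊗ g))
                ≈ Tr {_} {_} {t} x f ⊗ g
  yanking     : {t : T b} → ∀ x → Tr {_} {_} {t} x (swap x x) ≈ id x

cast-cong : ∀ {b G m m′ n n′} (p : m ≡ m′) (q : n ≡ n′) {f g : Term b G m n} →
            f ≈ g → cast p q f ≈ cast p q g
cast-cong refl refl f≈g = f≈g

module Circuits (S : Signature) where
  open Signature S

  data Gate : ℕ → ℕ → Set where
    prim  : (p : Prim) → Gate (dom p) (cod p)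
    fork  : Gate 1 2
    join  : Gate 2 1
    intro : Gate 0 1
    elim  : Gate 1 0

  data Component : ℕ → ℕ → Set where
    gate  : ∀ {m n} → Gate m n → Component m n
    -- The proof is irrelevant, so there is exactly one generator per value v ≢ •.
    value : (v : Value) → .(v ≢ •) → Component 0 1
    delay : Component 1 1

  CCirc SCirc : ℕ → ℕ → Set
  CCirc = Term false Gate
  SCirc = Term true Component

  embed : ∀ {m n} → CCirc m n → SCirc m n
  embed (gen g)    = gen (gate g)
  embed (id n)     = id n
  embed (swap m n) = swap m n
  embed (f ⨾ g)    = embed f ⨾ embed g
  embed (f ⊗ g)    = embed f ⊗ embed g

  intros : ∀ n → CCirc 0 n
  intros zero    = id 0
  intros (suc n) = gen intro ⊗ intros n

  elims : ∀ n → CCirc n 0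
  elims zero    = id 0
  elims (suc n) = gen elim ⊗ elims n

  forks : ∀ n → CCirc n (n + n)
  forks zero    = id 0
  forks (suc n) =
    (gen fork ⊗ forks n) ⨾
    (id 1 ⊗ cast refl (ℕ.+-assoc n 1 n) (swap 1 n ⊗ id n))

  -- The cast is the identification x + 0 = x on the output of id x ⊗ elims n.
  iteration : ∀ x {m n} → CCirc (x + m) (x + n) → ℕ → CCirc m (x + n)
  iteration x {m} f zero        = (intros x ⊗ id m) ⨾ f
  iteration x {m} {n} f (suc k) =
    forks m ⨾
    (cast refl (ℕ.+-identityʳ x) (iteration x f k ⨾ (id x ⊗ elims n)) ⊗ id m) ⨾
    f

  iteration-cong : ∀ x {m n} {f g : CCirc (x + m) (x + n)} → f ≈ g →
                   ∀ k → iteration x f k ≈ iteration x g k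
  iteration-cong x f≈g zero    = ⨾-cong ≈-refl f≈g
  iteration-cong x f≈g (suc k) =
    ⨾-cong (⨾-cong ≈-refl (⊗-cong
      (cast-cong refl (ℕ.+-identityʳ x) (⨾-cong (iteration-cong x f≈g k) ≈-refl)) ≈-refl)) f≈g

  embed-cast : ∀ {m m′ n n′} (p : m ≡ m′) (q : n ≡ n′) (f : CCirc m n) →
               cast p q (embed f) ≡ embed (cast p q f)
  embed-cast refl refl f = refl

  embed-cong : ∀ {m n} {f g : CCirc m n} → f ≈ g → embed f ≈ embed g
  embed-cong ≈-refl                = ≈-refl
  embed-cong (≈-sym p)             = ≈-sym (embed-cong p)
  embed-cong (≈-trans p q)         = ≈-trans (embed-cong p) (embed-cong q)
  embed-cong (⨾-cong p q)          = ⨾-cong (embed-cong p) (embed-cong q)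
  embed-cong (⊗-cong p q)          = ⊗-cong (embed-cong p) (embed-cong q)
  embed-cong (⨾-assoc f g h)       = ⨾-assoc _ _ _
  embed-cong (⨾-identityˡ f)       = ⨾-identityˡ _
  embed-cong (⨾-identityʳ f)       = ⨾-identityʳ _
  embed-cong (⊗-id m n)            = ⊗-id m n
  embed-cong (⊗-⨾ f g f′ g′)       = ⊗-⨾ _ _ _ _
  embed-cong (⊗-assoc {m} {n} {p} {q} {r} {s} f g h) =
    subst (_≈ embed (f ⊗ (g ⊗ h))) (embed-cast (ℕ.+-assoc m p r) (ℕ.+-assoc n q s) ((f ⊗ g) ⊗ h))
      (⊗-assoc _ _ _)
  embed-cong (⊗-identityˡ f)       = ⊗-identityˡ _
  embed-cong (⊗-identityʳ {m} {n} f) =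
    subst (_≈ embed f) (embed-cast (ℕ.+-identityʳ m) (ℕ.+-identityʳ n) (f ⊗ id 0))
      (⊗-identityʳ _)
  embed-cong (swap-natural f g)    = swap-natural _ _
  embed-cong (swap-involutive m n) = swap-involutive m n
  embed-cong (swap-hexagon m n p)  =
    subst (_≈ _)
      (trans
        (cong (λ c → cast (ℕ.+-assoc m n p) (sym (ℕ.+-assoc n p m))
                       ((swap m n ⊗ id p) ⨾ c))
          (embed-cast (sym (ℕ.+-assoc n m p)) refl (id n ⊗ swap m p)))
        (embed-cast (ℕ.+-assoc m n p) (sym (ℕ.+-assoc n p m))
          ((swap m n ⊗ id p) ⨾ cast (sym (ℕ.+-assoc n m p)) refl (id n ⊗ swap m p))))
      (swap-hexagon m n p)

record Interpretation (S : Signature) : Set₁ where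
  open Signature S
  infix 4 _≤_
  field
    _≤_         : Value → Value → Set
    _⊔_ _⊓_     : Value → Value → Value
    isLattice   : IsLattice _≡_ _≤_ _⊔_ _⊓_
    •-least     : ∀ v → • ≤ v
    apply       : (p : Prim) → Vec Value (dom p) → Vec Value (cod p)
    apply-⊥     : ∀ p → apply p (replicate (dom p) •) ≡ replicate (cod p) •
    apply-mono  : ∀ p {u v} → Pointwise _≤_ u v → Pointwise _≤_ (apply p u) (apply p v)

module Semantics {S : Signature} (I : Interpretation S) where
  open Signature S
  open Interpretation I
  open Circuits S
  private module L = IsLattice isLattice

  infix 4 _⊑_ _⊏_ _⊑ˢ_ _≋_ _≋ˢ_

  _⊑_ : ∀ {n} → Vec Value n → Vec Value n → Set
  _⊑_ = Pointwise _≤_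

  _⊏_ : ∀ {n} → Vec Value n → Vec Value n → Set
  u ⊏ v = u ⊑ v × u ≢ v

  -- `Chain v k` is the type of chains v = v₀ ⊏ v₁ ⊏ ⋯ ⊏ vₖ, which have length k.
  data Chain {n} : Vec Value n → ℕ → Set where
    [_] : ∀ v → Chain v 0
    _∷_ : ∀ {u v k} → u ⊏ v → Chain v k → Chain u (suc k)

  IsLongestChainLength : ℕ → ℕ → Set
  IsLongestChainLength n c =
    (∃ λ (v : Vec Value n) → Chain v c) ×
    (∀ {v : Vec Value n} {k} → Chain v k → k ℕ.≤ c)

  ⊥ⱽ : ∀ {n} → Vec Value n
  ⊥ⱽ = replicate _ •

  ⊑-refl : ∀ {n} {u : Vec Value n} → u ⊑ u
  ⊑-refl = Pointwise.refl L.refl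

  ⊑-reflexive : ∀ {n} {u v : Vec Value n} → u ≡ v → u ⊑ v
  ⊑-reflexive refl = ⊑-refl

  ⊑-trans : ∀ {n} {u v w : Vec Value n} → u ⊑ v → v ⊑ w → u ⊑ w
  ⊑-trans = Pointwise.trans L.trans

  ⊑-antisym : ∀ {n} {u v : Vec Value n} → u ⊑ v → v ⊑ u → u ≡ v
  ⊑-antisym []       []       = refl
  ⊑-antisym (p ∷ ps) (q ∷ qs) = cong₂ _∷_ (L.antisym p q) (⊑-antisym ps qs)

  ⊥ⱽ-least : ∀ {n} (v : Vec Value n) → ⊥ⱽ ⊑ v
  ⊥ⱽ-least []      = []
  ⊥ⱽ-least (x ∷ v) = •-least x ∷ ⊥ⱽ-least v

  ++-mono : ∀ {m n} {u u′ : Vec Value m} {v v′ : Vec Value n} →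
            u ⊑ u′ → v ⊑ v′ → u ++ v ⊑ u′ ++ v′
  ++-mono = Pointwise.++⁺

  take-mono : ∀ m {n} {u v : Vec Value (m + n)} → u ⊑ v → take m u ⊑ take m v
  take-mono zero    p                                     = []
  take-mono (suc m) {u = _ ∷ _} {v = _ ∷ _} (p ∷ ps)      = p ∷ take-mono m ps

  drop-mono : ∀ m {n} {u v : Vec Value (m + n)} → u ⊑ v → drop m u ⊑ drop m v
  drop-mono zero    p                                     = p
  drop-mono (suc m) {u = _ ∷ _} {v = _ ∷ _} (p ∷ ps)      = drop-mono m ps

  take-++ : ∀ {m n} (u : Vec Value m) (v : Vec Value n) → take m (u ++ v) ≡ u
  take-++ []      v = refl
  take-++ (x ∷ u) v = cong (x ∷_) (take-++ u v)

  drop-++ : ∀ {m n} (u : Vec Value m) (v : Vec Value n) → drop m (u ++ v) ≡ v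
  drop-++ []      v = refl
  drop-++ (x ∷ u) v = drop-++ u v

  _≟_ : Decidable {A = Value} _≡_
  _≟_ = via-injection (↔⇒↣ finite) Data.Fin.Properties._≟_

  _≟ⱽ_ : ∀ {n} → Decidable {A = Vec Value n} _≡_
  _≟ⱽ_ = Vec.≡-dec _≟_

  _≤?_ : Decidable _≤_
  u ≤? v = map′ (λ eq → subst (u ≤_) eq (L.x≤x∨y u v))
                (λ p → L.antisym (L.∨-least p L.refl) (L.y≤x∨y u v))
                ((u ⊔ v) ≟ v)

  _⊏?_ : ∀ {n} → Decidable (_⊏_ {n})
  u ⊏? v = Pointwise.decidable _≤?_ u v ×-dec ¬? (u ≟ⱽ v)

  values : List Value
  values = List.map (Inverse.from finite) (List.allFin size)

  ∈-values : ∀ v → v ∈ values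
  ∈-values v = subst (_∈ values) (Inverse.strictlyInverseʳ finite v)
                 (∈-map⁺ (Inverse.from finite) (∈-allFin (Inverse.to finite v)))

  vectors : ∀ n → List (Vec Value n)
  vectors zero    = [] ∷ []
  vectors (suc n) = List.cartesianProductWith _∷_ values (vectors n)

  ∈-vectors : ∀ {n} (v : Vec Value n) → v ∈ vectors n
  ∈-vectors []      = here refl
  ∈-vectors (x ∷ v) = ∈-cartesianProductWith⁺ _∷_ (∈-values x) (∈-vectors v)

  decide∃ : ∀ {n} {P : Vec Value n → Set} → (∀ v → Dec (P v)) → Dec (∃ P)
  decide∃ {n} P? = map′ Any.satisfied
                        (λ (v , p) → Any.map (λ { refl → p }) (∈-vectors v))
                        (any? P? (vectors n))

  chain? : ∀ {n} (v : Vec Value n) k → Dec (Chain v k)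
  chain? v zero    = yes [ v ]
  chain? v (suc k) = map′ (λ (w , p , c) → p ∷ c) (λ { (p ∷ c) → _ , p , c })
                          (decide∃ (λ w → (v ⊏? w) ×-dec chain? w k))

  chain-lookup : ∀ {n k} {v : Vec Value n} → Chain v k → Fin (suc k) → Vec Value n
  chain-lookup {v = v} c       zero    = v
  chain-lookup         (p ∷ c) (suc i) = chain-lookup c i

  chain-minimum : ∀ {n k} {v : Vec Value n} (c : Chain v k) i → v ⊑ chain-lookup c i
  chain-minimum c             zero    = ⊑-refl
  chain-minimum ((p , _) ∷ c) (suc i) = ⊑-trans p (chain-minimum c i)

  chain-injective : ∀ {n k} {v : Vec Value n} (c : Chain v k) {i j} →
                    chain-lookup c i ≡ chain-lookup c j → i ≡ j
  chain-injective c {zero} {zero} eq = refl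
  chain-injective ((p , p≢) ∷ c) {zero} {suc j} eq =
    contradiction (⊑-antisym p (subst (_ ⊑_) (sym eq) (chain-minimum c j))) p≢
  chain-injective ((p , p≢) ∷ c) {suc i} {zero} eq =
    contradiction (⊑-antisym p (subst (_ ⊑_) eq (chain-minimum c i))) p≢
  chain-injective (p ∷ c) {suc i} {suc j} eq = cong suc (chain-injective c eq)

  chain-bound : ∀ {n k} {v : Vec Value n} → Chain v k → k ℕ.≤ List.length (vectors n)
  chain-bound {n} c = ℕ.<⇒≤ (injective⇒≤ {f = f} f-injective)
    where
    f = λ i → Any.index (∈-vectors (chain-lookup c i))
    f-injective : ∀ {i j} → f i ≡ f j → i ≡ j
    f-injective {i} {j} eq = chain-injective c
      (trans (lookup-index (∈-vectors (chain-lookup c i)))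
        (trans (cong (List.lookup (vectors n)) eq)
          (sym (lookup-index (∈-vectors (chain-lookup c j))))))

  longestChain : ∀ n → ∃ (IsLongestChainLength n)
  longestChain n = search (List.length (vectors n)) chain-bound
    where
    search : ∀ b → (∀ {v : Vec Value n} {k} → Chain v k → k ℕ.≤ b) →
             ∃ (IsLongestChainLength n)
    search zero    bound = 0 , (⊥ⱽ , [ ⊥ⱽ ]) , bound
    search (suc b) bound with decide∃ (λ (v : Vec Value n) → chain? v (suc b))
    ... | yes c = suc b , c , bound
    ... | no ¬c = search b λ {v} {k} c →
      ℕ.≤-pred (ℕ.≤∧≢⇒< (bound c) (λ { refl → ¬c (v , c) }))

  unrolling : ∀ x {m n} → CCirc (x + m) (x + n) → CCirc m (x + n)
  unrolling x f = iteration x f (suc (proj₁ (longestChain x)))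

  Stream : ℕ → Set
  Stream n = ℕ → Vec Value n

  _⊑ˢ_ : ∀ {n} → Stream n → Stream n → Set
  σ ⊑ˢ τ = ∀ i → σ i ⊑ τ i

  _⧺_ : ∀ {m n} → Stream m → Stream n → Stream (m + n)
  (σ ⧺ τ) i = σ i ++ τ i

  _◂_ : ∀ {n} → Vec Value n → Stream n → Stream n
  (a ◂ σ) zero    = a
  (a ◂ σ) (suc i) = σ i

  ⊥ˢ : ∀ {n} → Stream n
  ⊥ˢ _ = ⊥ⱽ

  Causal : ∀ {m n} → (Stream m → Stream n) → Set
  Causal f = ∀ {σ τ} i → (∀ {j} → j ℕ.≤ i → σ j ≡ τ j) → f σ i ≡ f τ i

  Monotone : ∀ {m n} → (Stream m → Stream n) → Set
  Monotone f = ∀ {σ τ} → σ ⊑ˢ τ → f σ ⊑ˢ f τ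

  record CausalMonotone (m n : ℕ) : Set where
    field
      fun      : Stream m → Stream n
      causal   : Causal fun
      monotone : Monotone fun

    fun-cong : ∀ {σ τ} → (∀ i → σ i ≡ τ i) → ∀ i → fun σ i ≡ fun τ i
    fun-cong eq i = causal i (λ {j} _ → eq j)

  open CausalMonotone

  _≋_ : ∀ {m n} → CausalMonotone m n → CausalMonotone m n → Set
  f ≋ g = ∀ σ i → fun f σ i ≡ fun g σ i

  -- The stream derivative f_a, given by σ ↦ tail (f (a :: σ)).
  derivative : ∀ {m n} → CausalMonotone m n → Vec Value m → CausalMonotone m n
  derivative f a .fun σ i = fun f (a ◂ σ) (suc i)
  derivative f a .causal i eq =
    causal f (suc i) λ { {zero} _ → refl ; {suc j} (s≤s p) → eq p }
  derivative f a .monotone p i =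
    monotone f (λ { zero → ⊑-refl ; (suc j) → p j }) (suc i)

  derivatives : ∀ {m n} → CausalMonotone m n → List (Vec Value m) → CausalMonotone m n
  derivatives f []      = f
  derivatives f (a ∷ w) = derivatives (derivative f a) w

  -- f has finitely many iterated stream derivatives, up to extensional equality.
  FinitelySpecified : ∀ {m n} → CausalMonotone m n → Set
  FinitelySpecified f = ∃ λ gs → ∀ w → Any (derivatives f w ≋_) gs

  record StreamFunction (m n : ℕ) : Set where
    field
      map                 : CausalMonotone m n
      finitely-specified  : FinitelySpecified map

  open StreamFunction

  -- A family closed under derivatives and covered by a finite list.
  finite-family : ∀ {m n} {A : Set} (h : A → CausalMonotone m n)
                  (gs : List (CausalMonotone m n)) → (∀ s → Any (h s ≋_) gs) →
                  (∀ s a → ∃ λ s′ → derivative (h s) a ≋ h s′) →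
                  ∀ s → FinitelySpecified (h s)
  finite-family {m} h gs cover step s = gs , λ w → go s w (h s) (λ _ _ → refl)
    where
    go : ∀ s w f → f ≋ h s → Any (derivatives f w ≋_) gs
    go s []      f eq = Any.map (λ p σ i → trans (eq σ i) (p σ i)) (cover s)
    go s (a ∷ w) f eq with step s a
    ... | s′ , eq′ = go s′ w (derivative f a)
                        (λ σ i → trans (eq (a ◂ σ) (suc i)) (eq′ σ i))

  derivatives-snoc : ∀ {m n} (f : CausalMonotone m n) w a →
                     derivatives f (w List.∷ʳ a) ≡ derivative (derivatives f w) a
  derivatives-snoc f []      a = refl
  derivatives-snoc f (b ∷ w) a = derivatives-snoc (derivative f b) w a

  pointwise : ∀ {m n} (h : Vec Value m → Vec Value n) →
              (∀ {u v} → u ⊑ v → h u ⊑ h v) → CausalMonotone m n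
  pointwise h mono .fun σ i      = h (σ i)
  pointwise h mono .causal i eq  = cong h (eq ℕ.≤-refl)
  pointwise h mono .monotone p i = mono (p i)

  wires : ∀ {n} → CausalMonotone n n
  wires = pointwise (λ v → v) (λ p → p)

  elementwise : ∀ {m n} (h : Vec Value m → Vec Value n) →
                (∀ {u v} → u ⊑ v → h u ⊑ h v) → StreamFunction m n
  elementwise h mono .map                = pointwise h mono
  elementwise h mono .finitely-specified =
    finite-family {A = ⊤} (λ _ → pointwise h mono) (pointwise h mono ∷ [])
      (λ _ → here (λ _ _ → refl)) (λ _ _ → tt , λ _ _ → refl) tt

  delayFrom : ∀ {n} → Vec Value n → CausalMonotone n n
  delayFrom a .fun σ                              = a ◂ σ
  delayFrom a .causal   zero    eq                = refl
  delayFrom a .causal   (suc i) eq                = eq (ℕ.n≤1+n i)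
  delayFrom a .monotone p       zero              = ⊑-refl
  delayFrom a .monotone p       (suc i)           = p i

  delayˢ : ∀ {n} → StreamFunction n n
  delayˢ .map                = delayFrom ⊥ⱽ
  delayˢ .finitely-specified =
    finite-family delayFrom (List.map delayFrom (vectors _))
      (λ a → map⁺ (Any.map (λ { refl _ _ → refl }) (∈-vectors a)))
      (λ a b → b , λ { σ zero → refl ; σ (suc i) → refl })
      ⊥ⱽ

  sourceFrom : ∀ {n} → Vec Value n → CausalMonotone 0 n
  sourceFrom a .fun _            = a ◂ ⊥ˢ
  sourceFrom a .causal _ _       = refl
  sourceFrom a .monotone _ _     = ⊑-refl

  sourceˢ : ∀ {n} → Vec Value n → StreamFunction 0 n
  sourceˢ a .map                = sourceFrom a
  sourceˢ a .finitely-specified =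
    finite-family sourceFrom (List.map sourceFrom (vectors _))
      (λ b → map⁺ (Any.map (λ { refl _ _ → refl }) (∈-vectors b)))
      (λ b _ → ⊥ⱽ , λ { σ zero → refl ; σ (suc i) → refl })
      a

  compose : ∀ {m n p} → CausalMonotone m n → CausalMonotone n p → CausalMonotone m p
  compose f g .fun σ            = fun g (fun f σ)
  compose f g .causal i eq      =
    causal g i λ {j} j≤i → causal f j λ k≤j → eq (ℕ.≤-trans k≤j j≤i)
  compose f g .monotone p       = monotone g (monotone f p)

  parallel : ∀ {m n p q} → CausalMonotone m n → CausalMonotone p q →
             CausalMonotone (m + p) (n + q)
  parallel {m} f g .fun σ          = fun f (take m ∘ σ) ⧺ fun g (drop m ∘ σ)
  parallel {m} f g .causal i eq    =
    cong₂ _++_ (causal f i (λ p → cong (take m) (eq p)))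
               (causal g i (λ p → cong (drop m) (eq p)))
  parallel {m} f g .monotone p i   =
    ++-mono (monotone f (λ j → take-mono m (p j)) i)
            (monotone g (λ j → drop-mono m (p j)) i)

  compose-derivative : ∀ {m n p} (f : CausalMonotone m n) (g : CausalMonotone n p) a →
    derivative (compose f g) a ≋
    compose (derivative f a) (derivative g (fun f (a ◂ ⊥ˢ) 0))
  compose-derivative f g a σ i = fun-cong g
    (λ { zero → causal f 0 (λ { z≤n → refl }) ; (suc j) → refl }) (suc i)

  parallel-derivative : ∀ {m n p q} (f : CausalMonotone m n) (g : CausalMonotone p q) a →
    derivative (parallel f g) a ≋
    parallel (derivative f (take m a)) (derivative g (drop m a))
  parallel-derivative f g a σ i = cong₂ _++_
    (fun-cong f (λ { zero → refl ; (suc j) → refl }) (suc i))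
    (fun-cong g (λ { zero → refl ; (suc j) → refl }) (suc i))

  infixl 5 _⨾ˢ_
  infixr 6 _⊗ˢ_

  _⨾ˢ_ : ∀ {m n p} → StreamFunction m n → StreamFunction n p → StreamFunction m p
  (f ⨾ˢ g) .map                = compose (map f) (map g)
  (f ⨾ˢ g) .finitely-specified =
    finite-family {A = _ × _}
      (λ (w , w′) → compose (derivatives (map f) w) (derivatives (map g) w′))
      (List.cartesianProductWith compose (proj₁ (finitely-specified f))
                                         (proj₁ (finitely-specified g)))
      (λ (w , w′) → cartesianProductWith⁺ compose
        (λ {f′} {g′} p q σ i → trans (q _ i) (fun-cong g′ (p σ) i))
        (proj₂ (finitely-specified f) w) (proj₂ (finitely-specified g) w′))
      (λ (w , w′) a → (w List.∷ʳ a , w′ List.∷ʳ _) ,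
        subst₂ (λ f′ g′ → derivative (compose (derivatives (map f) w)
                                              (derivatives (map g) w′)) a
                          ≋ compose f′ g′)
          (sym (derivatives-snoc (map f) w a)) (sym (derivatives-snoc (map g) w′ _))
          (compose-derivative (derivatives (map f) w) (derivatives (map g) w′) a))
      ([] , [])

  _⊗ˢ_ : ∀ {m n p q} → StreamFunction m n → StreamFunction p q →
         StreamFunction (m + p) (n + q)
  (f ⊗ˢ g) .map                = parallel (map f) (map g)
  (f ⊗ˢ g) .finitely-specified =
    finite-family {A = _ × _}
      (λ (w , w′) → parallel (derivatives (map f) w) (derivatives (map g) w′))
      (List.cartesianProductWith parallel (proj₁ (finitely-specified f))
                                          (proj₁ (finitely-specified g)))
      (λ (w , w′) → cartesianProductWith⁺ parallel
        (λ p q σ i → cong₂ _++_ (p _ i) (q _ i))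
        (proj₂ (finitely-specified f) w) (proj₂ (finitely-specified g) w′))
      (λ (w , w′) a → (w List.∷ʳ _ , w′ List.∷ʳ _) ,
        subst₂ (λ f′ g′ → derivative (parallel (derivatives (map f) w)
                                               (derivatives (map g) w′)) a
                          ≋ parallel f′ g′)
          (sym (derivatives-snoc (map f) w _)) (sym (derivatives-snoc (map g) w′ _))
          (parallel-derivative (derivatives (map f) w) (derivatives (map g) w′) a))
      ([] , [])

  record IsLeastFixedPoint {n} (F : Stream n → Stream n) (μ : Stream n) : Set where
    field
      fixed : ∀ i → F μ i ≡ μ i
      least : ∀ τ → (∀ i → F τ i ≡ τ i) → μ ⊑ˢ τ

  open IsLeastFixedPoint

  lfp-unique : ∀ {n} {F : Stream n → Stream n} {μ ν} →
               IsLeastFixedPoint F μ → IsLeastFixedPoint F ν → ∀ i → μ i ≡ ν i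
  lfp-unique p q i = ⊑-antisym (least p _ (fixed q) i) (least q _ (fixed p) i)

  lfp-cong : ∀ {n} {F G : Stream n → Stream n} {μ} → (∀ τ i → F τ i ≡ G τ i) →
             IsLeastFixedPoint F μ → IsLeastFixedPoint G μ
  lfp-cong eq p .fixed i   = trans (sym (eq _ i)) (fixed p i)
  lfp-cong eq p .least τ q = least p τ (λ i → trans (eq τ i) (q i))

  iterate : ∀ {n} → (Stream n → Stream n) → ℕ → Stream n
  iterate F zero    = ⊥ˢ
  iterate F (suc k) = F (iterate F k)

  -- The least fixed point (see `μ-isLeastFixedPoint`) by Kleene iteration: each further entry stabilises after
  -- at most as many steps as the length of the longest chain of values.
  stage : ℕ → ℕ → ℕ
  stage n i = i * proj₁ (longestChain n)

  μ : ∀ {n} → (Stream n → Stream n) → Stream n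
  μ {n} F i = iterate F (stage n (suc i)) i

  module _ {n} (F : Stream n → Stream n) (F-causal : Causal F) (F-monotone : Monotone F) where
    private
      c = proj₁ (longestChain n)

    iterate-ascending : ∀ k → iterate F k ⊑ˢ iterate F (suc k)
    iterate-ascending zero    i = ⊥ⱽ-least _
    iterate-ascending (suc k)   = F-monotone (iterate-ascending k)

    climb : (a : ℕ → Vec Value n) → (∀ k → a k ⊑ a (suc k)) → ∀ j k →
            (∃ λ l → l ℕ.< j × a (l + k) ≡ a (suc (l + k))) ⊎ Chain (a k) j
    climb a up zero    k = inj₂ [ a k ]
    climb a up (suc j) k with a k ≟ⱽ a (suc k)
    ... | yes eq = inj₁ (0 , s≤s z≤n , eq)
    ... | no ¬eq with climb a up j (suc k)
    ...   | inj₂ ch            = inj₂ ((up k , ¬eq) ∷ ch)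
    ...   | inj₁ (l , l<j , e) = inj₁ (suc l , s≤s l<j ,
      subst (λ t → a t ≡ a (suc t)) (ℕ.+-suc l k) e)

    repeats : (a : ℕ → Vec Value n) → (∀ k → a k ⊑ a (suc k)) → ∀ k →
              ∃ λ l → l ℕ.≤ c × a (l + k) ≡ a (suc (l + k))
    repeats a up k with climb a up (suc c) k
    ... | inj₁ (l , s≤s p , e) = l , p , e
    ... | inj₂ ch = contradiction (proj₂ (proj₂ (longestChain n)) ch) (ℕ.<-irrefl refl)

    iterate-stable : ∀ i d {j} → j ℕ.< i →
                     iterate F (d + stage n i) j ≡ iterate F (suc (d + stage n i)) j
    iterate-stable (suc i) d {j} j<1+i = subst (λ t → iterate F t j ≡ iterate F (suc t) j)
      (ℕ.+-assoc d c (stage n i)) (later d (ℕ.≤-pred j<1+i))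
      where
      a = λ k → iterate F k i
      l = proj₁ (repeats a (λ k → iterate-ascending k i) (stage n i))
      l≤c : l ℕ.≤ c
      l≤c = proj₁ (proj₂ (repeats a (λ k → iterate-ascending k i) (stage n i)))

      upTo : ∀ e {j} → j ℕ.≤ i →
             iterate F (e + (l + stage n i)) j ≡ iterate F (suc (e + (l + stage n i))) j
      upTo zero {j} j≤i with ℕ.m≤n⇒m<n∨m≡n j≤i
      ... | inj₁ j<i  = iterate-stable i l j<i
      ... | inj₂ refl = proj₂ (proj₂ (repeats a (λ k → iterate-ascending k i) (stage n i)))
      upTo (suc e) {j} j≤i = F-causal j (λ k≤j → upTo e (ℕ.≤-trans k≤j j≤i))

      later : ∀ d {j} → j ℕ.≤ i →
              iterate F ((d + c) + stage n i) j ≡ iterate F (suc ((d + c) + stage n i)) j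
      later d {j} j≤i = subst (λ t → iterate F t j ≡ iterate F (suc t) j)
        (trans (sym (ℕ.+-assoc (d + (c ℕ.∸ l)) l (stage n i)))
          (cong (_+ stage n i)
            (trans (ℕ.+-assoc d (c ℕ.∸ l) l) (cong (d +_) (ℕ.m∸n+n≡m l≤c)))))
        (upTo (d + (c ℕ.∸ l)) j≤i)

    iterate-constant : ∀ i d {j} → j ℕ.< i →
                       iterate F (stage n i) j ≡ iterate F (d + stage n i) j
    iterate-constant i zero    j<i = refl
    iterate-constant i (suc d) j<i =
      trans (iterate-constant i d j<i) (iterate-stable i d j<i)

    μ-prefix : ∀ i {j} → j ℕ.≤ i → μ F j ≡ iterate F (stage n (suc i)) j
    μ-prefix i {j} j≤i = trans (iterate-constant (suc j) ((i ℕ.∸ j) * c) (s≤s ℕ.≤-refl))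
      (cong (λ t → iterate F t j)
        (trans (sym (ℕ.*-distribʳ-+ c (i ℕ.∸ j) (suc j)))
          (cong (_* c) (trans (ℕ.+-suc (i ℕ.∸ j) j) (cong suc (ℕ.m∸n+n≡m j≤i))))))

    iterate-prefixed : ∀ τ → F τ ⊑ˢ τ → ∀ k → iterate F k ⊑ˢ τ
    iterate-prefixed τ p zero    i = ⊥ⱽ-least _
    iterate-prefixed τ p (suc k) i = ⊑-trans (F-monotone (iterate-prefixed τ p k) i) (p i)

    μ-prefixed : ∀ τ → F τ ⊑ˢ τ → μ F ⊑ˢ τ
    μ-prefixed τ p i = iterate-prefixed τ p (stage n (suc i)) i

    μ-isLeastFixedPoint : IsLeastFixedPoint F (μ F)
    μ-isLeastFixedPoint .fixed i =
      trans (F-causal i (μ-prefix i)) (sym (iterate-stable (suc i) 0 ℕ.≤-refl))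
    μ-isLeastFixedPoint .least τ eq = μ-prefixed τ (λ i → ⊑-reflexive (eq i))

  feedback : ∀ x {m n} → CausalMonotone (x + m) (x + n) → Stream m → Stream x → Stream x
  feedback x f σ τ i = take x (fun f (τ ⧺ σ) i)

  feedback-causal : ∀ x {m n} (f : CausalMonotone (x + m) (x + n)) σ → Causal (feedback x f σ)
  feedback-causal x f σ i eq =
    cong (take x) (causal f i (λ {j} j≤i → cong (_++ σ j) (eq j≤i)))

  feedback-monotone : ∀ x {m n} (f : CausalMonotone (x + m) (x + n)) σ →
                      Monotone (feedback x f σ)
  feedback-monotone x f σ p i =
    take-mono x (monotone f (λ j → ++-mono (p j) ⊑-refl) i)

  feedback-lfp : ∀ x {m n} (f : CausalMonotone (x + m) (x + n)) σ →
                 IsLeastFixedPoint (feedback x f σ) (μ (feedback x f σ))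
  feedback-lfp x f σ =
    μ-isLeastFixedPoint _ (feedback-causal x f σ) (feedback-monotone x f σ)

  iterate-causal : ∀ x {m n} (f : CausalMonotone (x + m) (x + n)) {σ τ} k i →
                   (∀ {j} → j ℕ.≤ i → σ j ≡ τ j) →
                   iterate (feedback x f σ) k i ≡ iterate (feedback x f τ) k i
  iterate-causal x f zero    i eq = refl
  iterate-causal x f (suc k) i eq = cong (take x) (causal f i (λ {j} j≤i →
    cong₂ _++_ (iterate-causal x f k j (λ l≤j → eq (ℕ.≤-trans l≤j j≤i))) (eq j≤i)))

  iterate-monotone : ∀ x {m n} (f : CausalMonotone (x + m) (x + n)) {σ τ} → σ ⊑ˢ τ →
                     ∀ k → iterate (feedback x f σ) k ⊑ˢ iterate (feedback x f τ) k
  iterate-monotone x f p zero    i = ⊑-refl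
  iterate-monotone x f p (suc k) i =
    take-mono x (monotone f (λ j → ++-mono (iterate-monotone x f p k j) (p j)) i)

  trace : ∀ x {m n} → CausalMonotone (x + m) (x + n) → CausalMonotone m n
  trace x f .fun σ i       = drop x (fun f (μ (feedback x f σ) ⧺ σ) i)
  trace x f .causal i eq   = cong (drop x) (causal f i (λ {j} j≤i →
    cong₂ _++_ (iterate-causal x f (stage x (suc j)) j (λ k≤j → eq (ℕ.≤-trans k≤j j≤i)))
               (eq j≤i)))
  trace x f .monotone p i  = drop-mono x (monotone f (λ j →
    ++-mono (iterate-monotone x f p (stage x (suc j)) j) (p j)) i)

  trace-at : ∀ x {m n} (f : CausalMonotone (x + m) (x + n)) {σ ν} →
             IsLeastFixedPoint (feedback x f σ) ν →
             ∀ i → fun (trace x f) σ i ≡ drop x (fun f (ν ⧺ σ) i)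
  trace-at x f {σ} p i = cong (drop x)
    (fun-cong f (λ j → cong (_++ σ j) (lfp-unique (feedback-lfp x f σ) p j)) i)

  trace-cong : ∀ x {m n} (f g : CausalMonotone (x + m) (x + n)) →
               f ≋ g → trace x f ≋ trace x g
  trace-cong x f g eq σ i = trans
    (trace-at x f (lfp-cong (λ τ j → cong (take x) (sym (eq (τ ⧺ σ) j))) (feedback-lfp x g σ)) i)
    (cong (drop x) (eq (μ (feedback x g σ) ⧺ σ) i))

  trace-derivative : ∀ x {m n} (f : CausalMonotone (x + m) (x + n)) a →
    derivative (trace x f) a ≋
    trace x (derivative f (μ (feedback x f (a ◂ ⊥ˢ)) 0 ++ a))
  trace-derivative x {m} f a σ i = trans
    (cong (drop x) (fun-cong f unfold (suc i)))
    (sym (trace-at x f′ tail-lfp i))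
    where
    ν₀ = μ (feedback x f (a ◂ ⊥ˢ)) 0
    f′ = derivative f (ν₀ ++ a)
    ν  = μ (feedback x f (a ◂ σ))

    head-ν : ν 0 ≡ ν₀
    head-ν = iterate-causal x f (stage x 1) 0 (λ { z≤n → refl })

    split : ∀ (τ : Stream x) → τ 0 ≡ ν₀ → ∀ j →
            (τ ⧺ (a ◂ σ)) j ≡ ((ν₀ ++ a) ◂ ((τ ∘ suc) ⧺ σ)) j
    split τ eq zero    = cong (_++ a) eq
    split τ eq (suc j) = refl

    unfold = split ν head-ν

    tail-lfp : IsLeastFixedPoint (feedback x f′ σ) (ν ∘ suc)
    tail-lfp .fixed j = trans
      (cong (take x) (sym (fun-cong f unfold (suc j))))
      (fixed (feedback-lfp x f (a ◂ σ)) (suc j))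
    tail-lfp .least τ eq j =
      least (feedback-lfp x f (a ◂ σ)) (ν₀ ◂ τ) fixed′ (suc j)
      where
      fixed′ : ∀ k → feedback x f (a ◂ σ) (ν₀ ◂ τ) k ≡ (ν₀ ◂ τ) k
      fixed′ zero    = trans
        (feedback-causal x f (a ◂ σ) 0 (λ { z≤n → sym head-ν }))
        (trans (fixed (feedback-lfp x f (a ◂ σ)) 0) head-ν)
      fixed′ (suc k) = trans
        (cong (take x) (fun-cong f (split (ν₀ ◂ τ) refl) (suc k))) (eq k)

  traceˢ : ∀ x {m n} → StreamFunction (x + m) (x + n) → StreamFunction m n
  traceˢ x f .map                = trace x (map f)
  traceˢ x f .finitely-specified =
    finite-family (λ w → trace x (derivatives (map f) w))
      (List.map (trace x) (proj₁ (finitely-specified f)))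
      (λ w → map⁺ (Any.map (λ {g} → trace-cong x (derivatives (map f) w) g)
                           (proj₂ (finitely-specified f) w)))
      (λ w a → w List.∷ʳ _ ,
        subst (λ f′ → derivative (trace x (derivatives (map f) w)) a ≋ trace x f′)
          (sym (derivatives-snoc (map f) w _))
          (trace-derivative x (derivatives (map f) w) a))
      []

  ⟦_⟧ᶜ : ∀ {m n} → Component m n → StreamFunction m n
  ⟦ gate (prim p) ⟧ᶜ = elementwise (apply p) (apply-mono p)
  ⟦ gate fork     ⟧ᶜ = elementwise (λ { (v ∷ []) → v ∷ v ∷ [] })
                         (λ { (p ∷ []) → p ∷ p ∷ [] })
  ⟦ gate join     ⟧ᶜ = elementwise (λ { (u ∷ v ∷ []) → (u ⊔ v) ∷ [] })
                         (λ { (p ∷ q ∷ []) →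
                           L.∨-least (L.trans p (L.x≤x∨y _ _)) (L.trans q (L.y≤x∨y _ _)) ∷ [] })
  ⟦ gate intro    ⟧ᶜ = elementwise (λ _ → • ∷ []) (λ _ → ⊑-refl)
  ⟦ gate elim     ⟧ᶜ = elementwise (λ _ → []) (λ _ → [])
  ⟦ value v _     ⟧ᶜ = sourceˢ (v ∷ [])
  ⟦ delay         ⟧ᶜ = delayˢ

  ⟦_⟧ : ∀ {m n} → SCirc m n → StreamFunction m n
  ⟦ gen g    ⟧ = ⟦ g ⟧ᶜ
  ⟦ id n     ⟧ = elementwise (λ v → v) (λ p → p)
  ⟦ swap m n ⟧ = elementwise (λ v → drop m v ++ take m v)
                   (λ p → ++-mono (drop-mono m p) (take-mono m p))
  ⟦ f ⨾ g    ⟧ = ⟦ f ⟧ ⨾ˢ ⟦ g ⟧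
  ⟦ f ⊗ g    ⟧ = ⟦ f ⟧ ⊗ˢ ⟦ g ⟧
  ⟦ Tr x f   ⟧ = traceˢ x ⟦ f ⟧

  _≋ˢ_ : ∀ {m n} → StreamFunction m n → StreamFunction m n → Set
  f ≋ˢ g = map f ≋ map g

  castⱽ : ∀ {m n} → m ≡ n → Vec Value m → Vec Value n
  castⱽ refl v = v

  castⱽ-∷ : ∀ {m n} (eq : m ≡ n) (eq′ : suc m ≡ suc n) x (v : Vec Value m) →
            castⱽ eq′ (x ∷ v) ≡ x ∷ castⱽ eq v
  castⱽ-∷ refl refl x v = refl

  castⱽ-sym : ∀ {m n} (p : m ≡ n) v → castⱽ (sym p) (castⱽ p v) ≡ v
  castⱽ-sym refl v = refl

  ++-assoc : ∀ {a b c} (u : Vec Value a) (v : Vec Value b) (w : Vec Value c) →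
             castⱽ (ℕ.+-assoc a b c) ((u ++ v) ++ w) ≡ u ++ (v ++ w)
  ++-assoc []      v w = refl
  ++-assoc {suc a} {b} {c} (x ∷ u) v w =
    trans (castⱽ-∷ (ℕ.+-assoc a b c) (ℕ.+-assoc (suc a) b c) x ((u ++ v) ++ w))
          (cong (x ∷_) (++-assoc u v w))

  ++-assoc⁻ : ∀ {a b c} (u : Vec Value a) (v : Vec Value b) (w : Vec Value c) →
              castⱽ (sym (ℕ.+-assoc a b c)) (u ++ (v ++ w)) ≡ (u ++ v) ++ w
  ++-assoc⁻ {a} {b} {c} u v w =
    trans (cong (castⱽ (sym (ℕ.+-assoc a b c))) (sym (++-assoc u v w)))
          (castⱽ-sym (ℕ.+-assoc a b c) ((u ++ v) ++ w))

  ++-identityʳ : ∀ {n} (v : Vec Value n) → castⱽ (ℕ.+-identityʳ n) (v ++ []) ≡ v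
  ++-identityʳ []      = refl
  ++-identityʳ {suc n} (x ∷ v) =
    trans (castⱽ-∷ (ℕ.+-identityʳ n) (ℕ.+-identityʳ (suc n)) x (v ++ []))
          (cong (x ∷_) (++-identityʳ v))

  vec₀ : (u v : Vec Value 0) → u ≡ v
  vec₀ [] [] = refl

  take-drop : ∀ m {n} (v : Vec Value (m + n)) → take m v ++ drop m v ≡ v
  take-drop m v = Vec.take++drop≡id m v

  split₃ : ∀ a b {c} (v : Vec Value (a + (b + c))) →
           take a v ++ (take b (drop a v) ++ drop b (drop a v)) ≡ v
  split₃ a b v = trans (cong (take a v ++_) (take-drop b (drop a v))) (take-drop a v)

  cast-split₃ : ∀ a b c (v : Vec Value (a + (b + c))) →
    castⱽ (sym (ℕ.+-assoc a b c)) v ≡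
    (take a v ++ take b (drop a v)) ++ drop b (drop a v)
  cast-split₃ a b c v = trans (cong (castⱽ (sym (ℕ.+-assoc a b c))) (sym (split₃ a b v)))
    (++-assoc⁻ (take a v) (take b (drop a v)) (drop b (drop a v)))

  cast-fun : ∀ {m m′ n n′} (p : m ≡ m′) (q : n ≡ n′) (f : SCirc m n) σ i →
    fun (map ⟦ cast p q f ⟧) σ i ≡ castⱽ q (fun (map ⟦ f ⟧) (castⱽ (sym p) ∘ σ) i)
  cast-fun refl refl f σ i = refl

  assoc-fun : ∀ {m n p q r s} (f : CausalMonotone m n) (g : CausalMonotone p q)
              (h : CausalMonotone r s) σ i →
    castⱽ (ℕ.+-assoc n q s)
      (fun (parallel (parallel f g) h) (castⱽ (sym (ℕ.+-assoc m p r)) ∘ σ) i)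
    ≡ fun (parallel f (parallel g h)) σ i
  assoc-fun {m} {n} {p} {q} {r} {s} f g h σ i = trans
    (++-assoc (fun f _ i) (fun g _ i) (fun h _ i))
    (cong₂ _++_ (fun-cong f (λ j → trans (cong (take m) (takes j)) (take-++ _ _)) i)
      (cong₂ _++_ (fun-cong g (λ j → trans (cong (drop m) (takes j)) (drop-++ (take m (σ j)) _)) i)
                  (fun-cong h (λ j → trans (cong (drop (m + p)) (cast-split₃ m p r (σ j)))
                                           (drop-++ (take m (σ j) ++ take p (drop m (σ j))) _)) i)))
    where
    takes : ∀ j → take (m + p) (castⱽ (sym (ℕ.+-assoc m p r)) (σ j)) ≡
                  take m (σ j) ++ take p (drop m (σ j))
    takes j = trans (cong (take (m + p)) (cast-split₃ m p r (σ j))) (take-++ _ _)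

  hexagon : ∀ m n p (v : Vec Value (m + (n + p))) →
    let swapⱽ : ∀ a b → Vec Value (a + b) → Vec Value (b + a)
        swapⱽ a b u = drop a u ++ take a u
        w = castⱽ (sym (ℕ.+-assoc m n p)) v
        y = castⱽ (sym (sym (ℕ.+-assoc n m p))) (swapⱽ m n (take (m + n) w) ++ drop (m + n) w)
    in castⱽ (sym (ℕ.+-assoc n p m)) (take n y ++ swapⱽ m p (drop n y)) ≡ swapⱽ m (n + p) v
  hexagon m n p v = trans (cong (castⱽ (sym (ℕ.+-assoc n p m)))
      (cong₂ _++_ (trans (cong (take n) y≡) (take-++ B _))
        (cong₂ _++_ (trans (cong (drop m) dy≡) (drop-++ A _))
                    (trans (cong (take m) dy≡) (take-++ A _)))))
    (trans (++-assoc⁻ B C A) (cong (_++ A) (take-drop n (drop m v))))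
    where
    A = take m v
    B = take n (drop m v)
    C = drop n (drop m v)
    w = castⱽ (sym (ℕ.+-assoc m n p)) v
    tw = take (m + n) w
    y = castⱽ (sym (sym (ℕ.+-assoc n m p))) ((drop m tw ++ take m tw) ++ drop (m + n) w)
    tw≡ : tw ≡ A ++ B
    tw≡ = trans (cong (take (m + n)) (cast-split₃ m n p v)) (take-++ (A ++ B) C)
    sym-sym : ∀ {a b} (eq : a ≡ b) (u : Vec Value a) → castⱽ (sym (sym eq)) u ≡ castⱽ eq u
    sym-sym refl u = refl
    y≡ : y ≡ B ++ (A ++ C)
    y≡ = trans (sym-sym (ℕ.+-assoc n m p) _) (trans
      (cong (castⱽ (ℕ.+-assoc n m p)) (cong₂ _++_
        (cong₂ _++_ (trans (cong (drop m) tw≡) (drop-++ A B))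
                    (trans (cong (take m) tw≡) (take-++ A B)))
        (trans (cong (drop (m + n)) (cast-split₃ m n p v)) (drop-++ (A ++ B) C))))
      (++-assoc B A C))
    dy≡ : drop n y ≡ A ++ C
    dy≡ = trans (cong (drop n) y≡) (drop-++ B _)

  tightening-sound : ∀ x {m m′ n n′} (f : CausalMonotone m m′)
    (g : CausalMonotone (x + m′) (x + n′)) (h : CausalMonotone n′ n) →
    trace x (compose (compose (parallel wires f) g) (parallel wires h))
    ≋ compose (compose f (trace x g)) h
  tightening-sound x f g h σ i = trans
    (trace-at x F ν-lfp i)
    (trans (drop-++ (take x (fun G (ν ⧺ σ) i)) _)
           (fun-cong h (λ j → cong (drop x) (inner ν j)) i))
    where
    G = compose (parallel wires f) g
    F = compose G (parallel wires h)
    ν = μ (feedback x g (fun f σ))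
    inner : ∀ τ j → fun G (τ ⧺ σ) j ≡ fun g (τ ⧺ fun f σ) j
    inner τ j = fun-cong g (λ k → cong₂ _++_ (take-++ (τ k) (σ k))
      (fun-cong f (λ l → drop-++ (τ l) (σ l)) k)) j
    ν-lfp : IsLeastFixedPoint (feedback x F σ) ν
    ν-lfp = lfp-cong
      (λ τ j → sym (trans (take-++ (take x (fun G (τ ⧺ σ) j)) _) (cong (take x) (inner τ j))))
      (feedback-lfp x g (fun f σ))

  sliding-sound : ∀ x y {m n} (f : CausalMonotone (x + m) (y + n)) (g : CausalMonotone y x) →
    trace x (compose f (parallel g wires)) ≋
    trace y (compose (parallel g wires) f)
  sliding-sound x y {m} {n} f g σ i = trans
    (trace-at x E gβ-lfp i)
    (trans (drop-++ (fun g (λ j → take y (fun f (fun g β ⧺ σ) j)) i) _)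
           (cong (drop y) (sym (inner β i))))
    where
    F = compose (parallel g wires) f
    E = compose f (parallel g wires)
    β = μ (feedback y F σ)
    inner : ∀ τ j → fun F (τ ⧺ σ) j ≡ fun f (fun g τ ⧺ σ) j
    inner τ = fun-cong f (λ k → cong₂ _++_ (fun-cong g (λ l → take-++ (τ l) (σ l)) k)
                                           (drop-++ (τ k) (σ k)))
    outer : ∀ τ j → feedback x E σ τ j ≡ fun g (λ k → take y (fun f (τ ⧺ σ) k)) j
    outer τ j = take-++ (fun g (λ k → take y (fun f (τ ⧺ σ) k)) j) _
    gβ-lfp : IsLeastFixedPoint (feedback x E σ) (fun g β)
    gβ-lfp .fixed j = trans (outer (fun g β) j) (fun-cong g (λ k →
      trans (cong (take y) (sym (inner β k))) (fixed (feedback-lfp y F σ) k)) j)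
    gβ-lfp .least τ eq j = ⊑-trans
      (monotone g (μ-prefixed (feedback y F σ) (feedback-causal y F σ) (feedback-monotone y F σ)
        ρ (λ k → ⊑-reflexive (cong (take y) (trans (inner ρ k)
                   (fun-cong f (λ l → cong (_++ σ l) (gρ l)) k))))) j)
      (⊑-reflexive (gρ j))
      where
      ρ = λ k → take y (fun f (τ ⧺ σ) k)
      gρ : ∀ j → fun g ρ j ≡ τ j
      gρ j = trans (sym (outer τ j)) (eq j)

  vanishing₀-sound : ∀ {m n} (f : CausalMonotone m n) → trace 0 f ≋ f
  vanishing₀-sound f σ = fun-cong f (λ j → cong (_++ σ j) (vec₀ _ []))

  -- Bekić's lemma
  vanishing₊-sound : ∀ x y {m n} (f : CausalMonotone ((x + y) + m) ((x + y) + n))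
    (f′ : CausalMonotone (x + (y + m)) (x + (y + n))) →
    (∀ σ i → fun f′ σ i ≡
      castⱽ (ℕ.+-assoc x y n) (fun f (castⱽ (sym (ℕ.+-assoc x y m)) ∘ σ) i)) →
    trace (x + y) f ≋ trace y (trace x f′)
  vanishing₊-sound x y {m} {n} f f′ eq σ i = trans
    (trace-at (x + y) f αβ-lfp i)
    (sym (trans (cong (drop y) (cong (drop x) (f′-at α β i)))
      (trans (cong (λ v → drop y (drop x v)) (cast-out (fun f ((α ⧺ β) ⧺ σ) i)))
        (trans (cong (drop y) (drop-++ (take x V) _)) (drop-++ (drop x V) _)))))
    where
    h = trace x f′
    β = μ (feedback y h σ)
    α = μ (feedback x f′ (β ⧺ σ))
    V = take (x + y) (fun f ((α ⧺ β) ⧺ σ) i)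
    f′-at : ∀ (τ : Stream x) (ρ : Stream y) j → fun f′ (τ ⧺ (ρ ⧺ σ)) j ≡
            castⱽ (ℕ.+-assoc x y n) (fun f ((τ ⧺ ρ) ⧺ σ) j)
    f′-at τ ρ j = trans (eq _ j) (cong (castⱽ (ℕ.+-assoc x y n))
      (fun-cong f (λ k → ++-assoc⁻ (τ k) (ρ k) (σ k)) j))
    cast-out : ∀ (v : Vec Value ((x + y) + n)) → castⱽ (ℕ.+-assoc x y n) v ≡
      take x (take (x + y) v) ++ (drop x (take (x + y) v) ++ drop (x + y) v)
    cast-out v = trans (cong (castⱽ (ℕ.+-assoc x y n)) (sym (trans
        (cong (_++ drop (x + y) v) (take-drop x (take (x + y) v))) (take-drop (x + y) v))))
      (++-assoc (take x (take (x + y) v)) (drop x (take (x + y) v)) (drop (x + y) v))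
    first : ∀ τ ρ j → feedback x f′ (ρ ⧺ σ) τ j ≡
            take x (feedback (x + y) f σ (τ ⧺ ρ) j)
    first τ ρ j = trans (cong (take x) (trans (f′-at τ ρ j) (cast-out _)))
      (take-++ (take x (feedback (x + y) f σ (τ ⧺ ρ) j)) _)
    second : ∀ τ ρ j → take y (drop x (fun f′ (τ ⧺ (ρ ⧺ σ)) j)) ≡
             drop x (feedback (x + y) f σ (τ ⧺ ρ) j)
    second τ ρ j = trans
      (cong (take y) (trans (cong (drop x) (trans (f′-at τ ρ j) (cast-out _)))
        (drop-++ (take x (feedback (x + y) f σ (τ ⧺ ρ) j)) _)))
      (take-++ (drop x (feedback (x + y) f σ (τ ⧺ ρ) j)) _)
    αβ-lfp : IsLeastFixedPoint (feedback (x + y) f σ) (α ⧺ β)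
    αβ-lfp .fixed j = trans (sym (take-drop x _)) (cong₂ _++_
      (trans (sym (first α β j)) (fixed (feedback-lfp x f′ (β ⧺ σ)) j))
      (trans (sym (second α β j)) (fixed (feedback-lfp y h σ) j)))
    αβ-lfp .least τ τ-fixed j =
      subst (α j ++ β j ⊑_) (take-drop x (τ j)) (++-mono (α⊑ j) (β⊑ j))
      where
      τ₁ = take x ∘ τ
      τ₂ = drop x ∘ τ
      at-τ : ∀ k → feedback (x + y) f σ (τ₁ ⧺ τ₂) k ≡ τ k
      at-τ k = trans
        (cong (take (x + y)) (fun-cong f (λ l → cong (_++ σ l) (take-drop x (τ l))) k))
        (τ-fixed k)
      τ₁-fixed : ∀ k → feedback x f′ (τ₂ ⧺ σ) τ₁ k ≡ τ₁ k
      τ₁-fixed k = trans (first τ₁ τ₂ k) (cong (take x) (at-τ k))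
      β⊑ : β ⊑ˢ τ₂
      β⊑ = μ-prefixed (feedback y h σ) (feedback-causal y h σ) (feedback-monotone y h σ) τ₂
        (λ k → ⊑-trans
          (take-mono y (drop-mono x (monotone f′ (λ l →
            ++-mono (least (feedback-lfp x f′ (τ₂ ⧺ σ)) τ₁ τ₁-fixed l) ⊑-refl) k)))
          (⊑-reflexive (trans (second τ₁ τ₂ k) (cong (drop x) (at-τ k)))))
      α⊑ : α ⊑ˢ τ₁
      α⊑ = μ-prefixed (feedback x f′ (β ⧺ σ)) (feedback-causal x f′ (β ⧺ σ))
        (feedback-monotone x f′ (β ⧺ σ)) τ₁
        (λ k → ⊑-trans
          (take-mono x (monotone f′ (λ l → ++-mono (⊑-refl {u = τ₁ l}) (++-mono (β⊑ l) ⊑-refl)) k))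
          (⊑-reflexive (τ₁-fixed k)))

  superposing-sound : ∀ x {m n p q} (f : CausalMonotone (x + m) (x + n))
    (g : CausalMonotone p q) (k : CausalMonotone (x + (m + p)) (x + (n + q))) →
    (∀ σ i → fun k σ i ≡ castⱽ (ℕ.+-assoc x n q)
      (fun (parallel f g) (castⱽ (sym (ℕ.+-assoc x m p)) ∘ σ) i)) →
    trace x k ≋ parallel (trace x f) g
  superposing-sound x {m} {n} {p} {q} f g k eq σ i = trans
    (trace-at x k ν-lfp i) (trans (cong (drop x) (k-at ν i)) (drop-++ (take x (fun f (ν ⧺ σ₁) i)) _))
    where
    σ₁ = take m ∘ σ
    ν = μ (feedback x f σ₁)
    k-at : ∀ τ j → fun k (τ ⧺ σ) j ≡
           take x (fun f (τ ⧺ σ₁) j) ++ (drop x (fun f (τ ⧺ σ₁) j) ++ fun g (drop m ∘ σ) j)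
    k-at τ j = trans (eq _ j) (trans
      (cong (castⱽ (ℕ.+-assoc x n q)) (cong₂ _++_
        (trans (fun-cong f (λ l → trans (cong (take (x + m)) (arg l)) (take-++ (τ l ++ σ₁ l) _)) j)
               (sym (take-drop x (fun f (τ ⧺ σ₁) j))))
        (fun-cong g (λ l → trans (cong (drop (x + m)) (arg l)) (drop-++ (τ l ++ σ₁ l) _)) j)))
      (++-assoc (take x (fun f (τ ⧺ σ₁) j)) _ _))
      where
      arg : ∀ l → castⱽ (sym (ℕ.+-assoc x m p)) (τ l ++ σ l) ≡
                  (τ l ++ σ₁ l) ++ drop m (σ l)
      arg l = trans (cong (λ v → castⱽ (sym (ℕ.+-assoc x m p)) (τ l ++ v))
                          (sym (take-drop m (σ l))))
                    (++-assoc⁻ (τ l) (σ₁ l) (drop m (σ l)))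
    ν-lfp : IsLeastFixedPoint (feedback x k σ) ν
    ν-lfp = lfp-cong (λ τ j → sym (trans (cong (take x) (k-at τ j))
                                        (take-++ (take x (fun f (τ ⧺ σ₁) j)) _)))
                     (feedback-lfp x f σ₁)

  ⟦⟧-cong : ∀ {m n} {f g : SCirc m n} → f ≈ g → ⟦ f ⟧ ≋ˢ ⟦ g ⟧
  ⟦⟧-cong ≈-refl σ i              = refl
  ⟦⟧-cong (≈-sym p) σ i           = sym (⟦⟧-cong p σ i)
  ⟦⟧-cong (≈-trans p q) σ i       = trans (⟦⟧-cong p σ i) (⟦⟧-cong q σ i)
  ⟦⟧-cong (⨾-cong {g = g} p q) σ i =
    trans (fun-cong (map ⟦ g ⟧) (⟦⟧-cong p σ) i) (⟦⟧-cong q _ i)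
  ⟦⟧-cong (⊗-cong p q) σ i        = cong₂ _++_ (⟦⟧-cong p _ i) (⟦⟧-cong q _ i)
  ⟦⟧-cong (Tr-cong x {f = f} {f′} p) =
    trace-cong x (map ⟦ f ⟧) (map ⟦ f′ ⟧) (⟦⟧-cong p)
  ⟦⟧-cong (⨾-assoc f g h) σ i     = refl
  ⟦⟧-cong (⨾-identityˡ f) σ i     = refl
  ⟦⟧-cong (⨾-identityʳ f) σ i     = refl
  ⟦⟧-cong (⊗-id m n) σ i          = take-drop m (σ i)
  ⟦⟧-cong (⊗-⨾ {m} f g f′ g′) σ i     = cong₂ _++_
    (fun-cong (map ⟦ g ⟧) (λ j → take-++ (fun (map ⟦ f ⟧) (λ k → take m (σ k)) j) _) i)
    (fun-cong (map ⟦ g′ ⟧) (λ j → drop-++ (fun (map ⟦ f ⟧) (λ k → take m (σ k)) j) _) i)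
  ⟦⟧-cong (⊗-assoc {m} {n} {p} {q} {r} {s} f g h) σ i = trans
    (cast-fun (ℕ.+-assoc m p r) (ℕ.+-assoc n q s) ((f ⊗ g) ⊗ h) σ i)
    (assoc-fun (map ⟦ f ⟧) (map ⟦ g ⟧) (map ⟦ h ⟧) σ i)
  ⟦⟧-cong (⊗-identityˡ f) σ i     = refl
  ⟦⟧-cong (⊗-identityʳ {m} {n} f) σ i = trans
    (cast-fun (ℕ.+-identityʳ m) (ℕ.+-identityʳ n) (f ⊗ id 0) σ i)
    (trans (cong (castⱽ (ℕ.+-identityʳ n)) (cong₂ _++_
        (fun-cong (map ⟦ f ⟧) (λ j → take-identityʳ m (σ j)) i) (vec₀ _ [])))
      (++-identityʳ (fun (map ⟦ f ⟧) σ i)))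
    where
    take-identityʳ : ∀ m (v : Vec Value m) → take m (castⱽ (sym (ℕ.+-identityʳ m)) v) ≡ v
    take-identityʳ m v = trans
      (cong (take m) (trans (cong (castⱽ (sym (ℕ.+-identityʳ m))) (sym (++-identityʳ v)))
                            (castⱽ-sym (ℕ.+-identityʳ m) (v ++ []))))
      (take-++ v [])
  ⟦⟧-cong (swap-natural {m} f g) σ i =
    cong₂ _++_
      (trans (drop-++ (fun (map ⟦ f ⟧) (λ j → take m (σ j)) i) _)
             (fun-cong (map ⟦ g ⟧) (λ j → sym (take-++ (drop m (σ j)) (take m (σ j)))) i))
      (trans (take-++ (fun (map ⟦ f ⟧) (λ j → take m (σ j)) i) _)
             (fun-cong (map ⟦ f ⟧) (λ j → sym (drop-++ (drop m (σ j)) (take m (σ j)))) i))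
  ⟦⟧-cong (swap-involutive m n) σ i =
    trans (cong₂ _++_ (drop-++ (drop m (σ i)) _) (take-++ (drop m (σ i)) _))
          (take-drop m (σ i))
  ⟦⟧-cong (swap-hexagon m n p) σ i = trans
    (cast-fun (ℕ.+-assoc m n p) (sym (ℕ.+-assoc n p m))
      ((swap m n ⊗ id p) ⨾ cast (sym (ℕ.+-assoc n m p)) refl (id n ⊗ swap m p)) σ i)
    (trans (cong (castⱽ (sym (ℕ.+-assoc n p m)))
      (cast-fun (sym (ℕ.+-assoc n m p)) refl (id n ⊗ swap m p) _ i))
      (hexagon m n p (σ i)))
  ⟦⟧-cong (tightening x f g h)    = tightening-sound x (map ⟦ f ⟧) (map ⟦ g ⟧) (map ⟦ h ⟧)
  ⟦⟧-cong (sliding x y f g)       = sliding-sound x y (map ⟦ f ⟧) (map ⟦ g ⟧)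
  ⟦⟧-cong (vanishing₀ f)          = vanishing₀-sound (map ⟦ f ⟧)
  ⟦⟧-cong (vanishing₊ x y {m} {n} f) = vanishing₊-sound x y (map ⟦ f ⟧)
    (map ⟦ cast (ℕ.+-assoc x y m) (ℕ.+-assoc x y n) f ⟧)
    (cast-fun (ℕ.+-assoc x y m) (ℕ.+-assoc x y n) f)
  ⟦⟧-cong (superposing x {m} {n} {p} {q} f g) =
    superposing-sound x (map ⟦ f ⟧) (map ⟦ g ⟧)
      (map ⟦ cast (ℕ.+-assoc x m p) (ℕ.+-assoc x n q) (f ⊗ g) ⟧)
      (cast-fun (ℕ.+-assoc x m p) (ℕ.+-assoc x n q) (f ⊗ g))
  ⟦⟧-cong (yanking x) σ i         = trans
    (trace-at x (map ⟦ swap x x ⟧) σ-lfp i)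
    (trans (drop-++ (drop x (σ i ++ σ i)) _) (take-++ (σ i) (σ i)))
    where
    σ-lfp : IsLeastFixedPoint (feedback x (map ⟦ swap x x ⟧) σ) σ
    σ-lfp .fixed j      = trans (take-++ (drop x (σ j ++ σ j)) (take x (σ j ++ σ j))) (drop-++ (σ j) (σ j))
    σ-lfp .least τ eq j = ⊑-reflexive
      (trans (sym (trans (take-++ (drop x (τ j ++ σ j)) (take x (τ j ++ σ j))) (drop-++ (τ j) (σ j)))) (eq j))

{-# OPTIONS --safe #-}
-- At each instant a combinational circuit acts as a monotone function of its current inputs
-- alone.  Hence the i-th entries of the Kleene iterates of its feedback are the iterates from ⊥
-- of one monotone function on 𝐕ˣ; they form an ascending sequence that is constant once two
-- consecutive terms agree, which happens within c steps.  So the c-th and all later iterates are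
-- the least fixed point at all instants simultaneously, and fᵏ denotes one application of f to
-- the k-th iterate.
module Submission where

open import Data.Nat as ℕ using (ℕ; zero; suc; _+_)
import Data.Nat.Properties as ℕ
open import Data.Product using (_,_; proj₁)
open import Data.Vec using (Vec; []; _∷_; _++_; take; drop)
open import Function using (_∘_)
open import Relation.Binary.PropositionalEquality using (_≡_; refl; sym; trans; cong; cong₂; subst)
open import Defs

module InstantFeedback {S : Signature} (I : Interpretation S) where
  open Signature S
  open Circuits S
  open Semantics I
  open CausalMonotone
  open StreamFunction
  open IsLeastFixedPoint

  Instantaneous : ∀ {m n} → (Stream m → Stream n) → Set
  Instantaneous f = ∀ {σ τ} i → σ i ≡ τ i → f σ i ≡ f τ i

  ⟪_⟫ : ∀ {m n} → CCirc m n → CausalMonotone m n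
  ⟪ f ⟫ = map ⟦ embed f ⟧

  -- Among the generators only `delay` reads an earlier instant, and it is not a `Gate`; composition
  -- and tensor preserve the property.
  ⟪⟫-instantaneous : ∀ {m n} (f : CCirc m n) → Instantaneous (fun ⟪ f ⟫)
  ⟪⟫-instantaneous (gen (prim p))  i eq = cong (apply p) eq
    where open Interpretation I
  -- The denotation is an anonymous pattern-matching function on vectors; evaluating it on a
  -- constant stream makes it available to `cong`.
  ⟪⟫-instantaneous (gen fork)      i eq = cong (λ v → fun ⟪ gen fork ⟫ (λ _ → v) 0) eq
  ⟪⟫-instantaneous (gen join)      i eq = cong (λ v → fun ⟪ gen join ⟫ (λ _ → v) 0) eq
  ⟪⟫-instantaneous (gen intro)     i eq = refl
  ⟪⟫-instantaneous (gen elim)      i eq = refl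
  ⟪⟫-instantaneous (id n)          i eq = eq
  ⟪⟫-instantaneous (swap m n)      i eq = cong (λ v → drop m v ++ take m v) eq
  ⟪⟫-instantaneous (f ⨾ g)         i eq = ⟪⟫-instantaneous g i (⟪⟫-instantaneous f i eq)
  ⟪⟫-instantaneous (_⊗_ {m} f g)   i eq = cong₂ _++_
    (⟪⟫-instantaneous f i (cong (take m) eq)) (⟪⟫-instantaneous g i (cong (drop m) eq))

  feedback-instantaneous : ∀ x {m n} (f : CausalMonotone (x + m) (x + n)) σ →
                           Instantaneous (fun f) → Instantaneous (feedback x f σ)
  feedback-instantaneous x f σ f-inst i eq = cong (take x) (f-inst i (cong (_++ σ i) eq))

  module _ {n} (F : Stream n → Stream n) (F-inst : Instantaneous F) (F-mono : Monotone F) where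
    private
      F-causal : Causal F
      F-causal i eq = F-inst i (eq ℕ.≤-refl)

    -- Equality at `i` alone passes through `F`; mere causality would ask for equality at all
    -- earlier instants as well.
    iterate-stays : ∀ {k l} i → k ℕ.≤′ l → iterate F k i ≡ iterate F (suc k) i →
                    iterate F l i ≡ iterate F (suc l) i
    iterate-stays i (ℕ.≤′-reflexive refl) eq = eq
    iterate-stays i (ℕ.≤′-step k≤l)       eq = F-inst i (iterate-stays i k≤l eq)

    -- The stage `l` at which the entries repeat depends on `i`, but its bound c does not, so one
    -- `k` serves every instant.
    iterate-lfp : ∀ {k} → proj₁ (longestChain n) ℕ.≤ k → IsLeastFixedPoint F (iterate F k)
    iterate-lfp {k} c≤k .fixed i
      with repeats F F-causal F-mono (λ j → iterate F j i)
             (λ j → iterate-ascending F F-causal F-mono j i) 0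
    ... | l , l≤c , eq = sym (iterate-stays i (ℕ.≤⇒≤′ l+0≤k) eq)
      where
      l+0≤k : l + 0 ℕ.≤ k
      l+0≤k = subst (ℕ._≤ k) (sym (ℕ.+-identityʳ l)) (ℕ.≤-trans l≤c c≤k)
    iterate-lfp {k} c≤k .least τ eq =
      iterate-prefixed F F-causal F-mono τ (λ i → ⊑-reflexive (eq i)) k

  intros-⊥ : ∀ n σ i → fun ⟪ intros n ⟫ σ i ≡ ⊥ⱽ
  intros-⊥ zero    σ i = vec₀ _ _
  intros-⊥ (suc n) σ i = cong (_ ∷_) (intros-⊥ n _ i)

  -- The unfolded denotation of the rewiring in `forks (suc n)`, which moves the second copy of the
  -- head past the first copy of the tail.
  interleave : ∀ n → Vec Value (2 + (n + n)) → Vec Value (suc n + suc n)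
  interleave n w = take 1 w ++ castⱽ (ℕ.+-assoc n 1 n)
    ((drop 1 (take (1 + n) (drop 1 w)) ++ take 1 (take (1 + n) (drop 1 w)))
      ++ drop (1 + n) (drop 1 w))

  interleave-copies : ∀ {n} a (u : Vec Value n) →
                      interleave n (a ∷ a ∷ u ++ u) ≡ (a ∷ u) ++ (a ∷ u)
  interleave-copies {n} a u = cong (a ∷_) (trans
    (cong₂ (λ t d → castⱽ (ℕ.+-assoc n 1 n) ((t ++ a ∷ []) ++ d)) (take-++ u u) (drop-++ u u))
    (++-assoc u (a ∷ []) u))

  forks-copy : ∀ n σ i → fun ⟪ forks n ⟫ σ i ≡ σ i ++ σ i
  forks-copy zero    σ i = vec₀ _ _
  forks-copy (suc n) σ i = trans
    (cong (take 1 (ρ i) ++_) (trans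
      -- `embed` is stuck on a `cast`, so the two are exchanged before `cast-fun` carries the cast
      -- over to vectors.
      (cong (λ h → fun (map ⟦ h ⟧) (drop 1 ∘ ρ) i)
        (sym (embed-cast refl (ℕ.+-assoc n 1 n) (swap 1 n ⊗ id n))))
      (cast-fun refl (ℕ.+-assoc n 1 n) (swap 1 n ⊗ id n) (drop 1 ∘ ρ) i)))
    (trans (cong (interleave n) ρ≡) (copies (σ i)))
    where
    ρ = fun ⟪ gen fork ⊗ forks n ⟫ σ
    ρ≡ : ρ i ≡ fun ⟪ gen fork ⟫ (take 1 ∘ σ) i ++ (drop 1 (σ i) ++ drop 1 (σ i))
    ρ≡ = cong (fun ⟪ gen fork ⟫ (take 1 ∘ σ) i ++_) (forks-copy n (drop 1 ∘ σ) i)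
    copies : ∀ (v : Vec Value (suc n)) →
             interleave n (fun ⟪ gen fork ⟫ (λ _ → take 1 v) i ++ (drop 1 v ++ drop 1 v)) ≡ v ++ v
    copies (a ∷ u) = interleave-copies a u

  discard-right : ∀ x {m n} (g : CCirc m (x + n)) σ i →
    fun ⟪ cast refl (ℕ.+-identityʳ x) (g ⨾ (id x ⊗ elims n)) ⟫ σ i ≡ take x (fun ⟪ g ⟫ σ i)
  discard-right x {n = n} g σ i = trans
    (cong (λ h → fun (map ⟦ h ⟧) σ i)
      (sym (embed-cast refl (ℕ.+-identityʳ x) (g ⨾ (id x ⊗ elims n)))))
    (trans
      (cast-fun refl (ℕ.+-identityʳ x) (embed (g ⨾ (id x ⊗ elims n))) σ i)
      (trans (cong (λ v → castⱽ (ℕ.+-identityʳ x) (take x (fun ⟪ g ⟫ σ i) ++ v)) (vec₀ _ []))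
             (++-identityʳ _)))

  -- The induction closes because the first `x` outputs of `f` at the `k`-th iterate are, by
  -- definition of `feedback`, the iterate `suc k` that the next copy of `f` reads.
  iteration-sound : ∀ x {m n} (f : CCirc (x + m) (x + n)) k σ i →
    fun ⟪ iteration x f k ⟫ σ i ≡ fun ⟪ f ⟫ (iterate (feedback x ⟪ f ⟫ σ) k ⧺ σ) i
  iteration-sound x f zero σ =
    fun-cong ⟪ f ⟫ (λ j → cong (_++ σ j) (intros-⊥ x _ j))
  iteration-sound x {m} f (suc k) σ = fun-cong ⟪ f ⟫ (λ j → cong₂ _++_
    (trans (discard-right x (iteration x f k) _ j)
      (cong (take x) (trans
        (fun-cong ⟪ iteration x f k ⟫
          (λ l → trans (cong (take m) (forks-copy m σ l)) (take-++ (σ l) (σ l))) j)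
        (iteration-sound x f k σ j))))
    (trans (cong (drop m) (forks-copy m σ j)) (drop-++ (σ j) (σ j))))

  instant-feedback : ∀ x {m n} (f : CCirc (x + m) (x + n)) →
    ⟦ Tr x (embed f) ⟧ ≋ˢ ⟦ embed (unrolling x f ⨾ (elims x ⊗ id n)) ⟧
  instant-feedback x {n = n} f σ i = trans
    -- `μ` uses a number of iterations that grows with the instant; by uniqueness of least fixed
    -- points the single iterate c + 1 may replace it.
    (trace-at x ⟪ f ⟫
      (iterate-lfp (feedback x ⟪ f ⟫ σ)
        (feedback-instantaneous x ⟪ f ⟫ σ (⟪⟫-instantaneous f))
        (feedback-monotone x ⟪ f ⟫ σ)
        (ℕ.n≤1+n _))
      i)
    (sym (trans (cong (_++ drop x (fun ⟪ unrolling x f ⟫ σ i)) (vec₀ _ []))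
                (cong (drop x) (iteration-sound x f (suc (proj₁ (longestChain x))) σ i))))

proposition5p19 :
    (S : Signature) (I : Interpretation S) →
    let open Circuits S
        open Semantics I in
    (x m n : ℕ) (f : CCirc (x + m) (x + n)) →
    ⟦ Tr x (embed f) ⟧ ≋ˢ ⟦ embed (unrolling x f ⨾ (elims x ⊗ id n)) ⟧
proposition5p19 S I x m n f = InstantFeedback.instant-feedback I x f
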